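{- Let $A$ be a commutative ring, let $k\ge 1$, let $\vec s=(n_1,\dots,n_k)$ be a tuple of positive integers, and let $X_\bullet=X_\bullet(\vec s;A)$ be the diagonal simplicial tensor module. For every $p\ge 1$ and every $0\le j\le p$, the horn kernel $R_{p,j}=\bigcap_{i\in[p]\setminus\{j\}}\ker(d_i^p:X_p\to X_{p-1})$ is non-trivial, i.e. $R_{p,j}\neq\{0\}$, if and only if $k\ge p$.
   Context: Notation: $[p]=\{0,\dots,p\}$. A shape is a tuple $\vec s=(n_1,\dots,n_k)$ of positive integers, $k\ge 1$; put $n=\min(n_1,\dots,n_k)-1$, $M_a(p)=n_a-1-n+p$ (so $M_a(p)\ge p$) and $I_p=\prod_{a=1}^k[M_a(p)]$ for $p\ge 0$. Let $\delta_i^q:[q-1]\to[q]$ be the increasing injection missing $i$ and $\sigma_i^q:[q+1]\to[q]$ the nondecreasing surjection taking the value $i$ twice. Define $\Delta_i^p=\prod_{a=1}^k\delta_i^{M_a(p)}:I_{p-1}\to I_p$ ($p\ge1$, $0\le i\le p$) and $\Sigma_i^p=\prod_{a=1}^k\sigma_i^{M_a(p)}:I_{p+1}\to I_p$ ($p\ge 0$, $0\le i\le p$). The diagonal simplicial tensor module $X_\bullet(\vec s;A)$ is the simplicial $A$-module with $X_p=A^{I_p}$ (all functions $T:I_p\to A$), faces $d_i^p(T)=T\circ\Delta_i^p$ and degeneracies $s_i^p(T)=T\circ\Sigma_i^p$.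
   Formalization: The commutative ring A is assumed to be nontrivial (1 ≠ 0); over the zero ring every X_p is {0}, so the horn kernel is trivial even when k ≥ p and the statement fails. -}

module Defs where

open import Algebra.Bundles using (CommutativeRing)
open import Algebra.Module.Bundles using (Module)
open import Algebra.Module.Morphism.Structures using (IsModuleHomomorphism)
import Algebra.Construct.Pointwise as Pointwise
open import Data.Fin.Base
  using (Fin; zero; suc; toℕ; inject₁; punchIn; pinch; _↑ˡ_; _≤_; _<_)
open import Data.Fin.Properties using (toℕ-↑ˡ)
open import Data.Nat.Base as ℕ using (ℕ; zero; suc; _+_; _∸_; _⊓_; NonZero; s≤s)
open import Data.Product.Base using (∃; _,_)
open import Data.Vec.Base using (Vec; foldr₁)
open import Data.Vec.Relation.Unary.All using (All; []; _∷_; map)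
open import Function.Base using (_∘_)
open import Level using (Level; _⊔_) renaming (suc to lsuc)
open import Relation.Binary.PropositionalEquality
  using (_≡_; _≢_; refl; sym; trans; cong; cong₂; subst₂)
open import Relation.Unary using (Pred; ⋂)

private
  variable
    c ℓ m ℓm m′ ℓm′ : Level
    n p k : ℕ

-- The simplicial identities are indexed so that no predecessor of an
-- index is needed: each pair "i < j" is written as "i , suc j" with i ≤ j.

record SimplicialModule (A : CommutativeRing c ℓ) m ℓm
                        : Set (c ⊔ ℓ ⊔ lsuc (m ⊔ ℓm)) where
  field
    X : ℕ → Module A m ℓm

  open module X {p} = Module (X p) public using (_≈ᴹ_; 0ᴹ)

  Simplex : ℕ → Set m
  Simplex p = Module.Carrierᴹ (X p)

  field
    d : Fin (suc (suc p)) → Simplex (suc p) → Simplex p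
    s : Fin (suc p) → Simplex p → Simplex (suc p)

    d-homo : (i : Fin (suc (suc p))) →
             IsModuleHomomorphism (Module.rawModule (X (suc p)))
                                  (Module.rawModule (X p)) (d i)
    s-homo : (i : Fin (suc p)) →
             IsModuleHomomorphism (Module.rawModule (X p))
                                  (Module.rawModule (X (suc p))) (s i)

    d-d   : (i j : Fin (suc (suc p))) → i ≤ j → ∀ x →
            d i (d (suc j) x) ≈ᴹ d j (d (inject₁ i) x)
    s-s   : (i j : Fin (suc p)) → i ≤ j → ∀ x →
            s (inject₁ i) (s j x) ≈ᴹ s (suc j) (s i x)
    d-s-< : (i : Fin (suc (suc p))) (j : Fin (suc p)) → i ≤ j → ∀ x →
            d (inject₁ i) (s (suc j) x) ≈ᴹ s j (d i x)
    d-s-≡ : (i : Fin (suc p)) → ∀ x → d (inject₁ i) (s i x) ≈ᴹ x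
    d-s-+ : (i : Fin (suc p)) → ∀ x → d (suc i) (s i x) ≈ᴹ x
    d-s-> : (i : Fin (suc (suc p))) (j : Fin (suc p)) → j < i → ∀ x →
            d (suc i) (s (inject₁ j) x) ≈ᴹ s j (d i x)

module _ {A : CommutativeRing c ℓ} where

  Ker : (M : Module A m ℓm) (N : Module A m′ ℓm′) →
        (Module.Carrierᴹ M → Module.Carrierᴹ N) → Pred (Module.Carrierᴹ M) ℓm′
  Ker M N f x = f x ≈ᴹ 0ᴹ where open Module N

  ｛0｝ : (M : Module A m ℓm) → Pred (Module.Carrierᴹ M) ℓm
  ｛0｝ M x = x ≈ᴹ 0ᴹ where open Module M

  module _ (S : SimplicialModule A m ℓm) where
    open SimplicialModule S

    hornKernel : ∀ p .{{_ : NonZero p}} → Fin (suc p) → Pred (Simplex p) ℓm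
    hornKernel (suc p) j =
      ⋂ (∃ λ i → i ≢ j) λ (i , _) → Ker (X (suc p)) (X p) (d i)

_^ᴹ_ : (A : CommutativeRing c ℓ) (I : Set) → Module A c ℓ
A ^ᴹ I = record
  { Carrierᴹ = I → Carrier
  ; _≈ᴹ_     = λ T U → ∀ x → T x ≈ U x
  ; _+ᴹ_     = λ T U x → T x A.+ U x
  ; _*ₗ_     = λ a T x → a * T x
  ; _*ᵣ_     = λ T a x → T x * a
  ; 0ᴹ       = λ _ → 0#
  ; -ᴹ_      = λ T x → - T x
  ; isModule = record
    { isBimodule = record
      { isBisemimodule = record
        { +ᴹ-isCommutativeMonoid = Pointwise.isCommutativeMonoid I +-isCommutativeMonoid
        ; isPreleftSemimodule = record
          { *ₗ-cong      = λ a≈b T≈U x → *-cong a≈b (T≈U x)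
          ; *ₗ-zeroˡ     = λ T x → zeroˡ (T x)
          ; *ₗ-distribʳ  = λ T a b x → distribʳ (T x) a b
          ; *ₗ-identityˡ = λ T x → *-identityˡ (T x)
          ; *ₗ-assoc     = λ a b T x → *-assoc a b (T x)
          ; *ₗ-zeroʳ     = λ a x → zeroʳ a
          ; *ₗ-distribˡ  = λ a T U x → distribˡ a (T x) (U x)
          }
        ; isPrerightSemimodule = record
          { *ᵣ-cong      = λ T≈U a≈b x → *-cong (T≈U x) a≈b
          ; *ᵣ-zeroʳ     = λ T x → zeroʳ (T x)
          ; *ᵣ-distribˡ  = λ T a b x → distribˡ (T x) a b
          ; *ᵣ-identityʳ = λ T x → *-identityʳ (T x)
          ; *ᵣ-assoc     = λ T a b x → *-assoc (T x) a b
          ; *ᵣ-zeroˡ     = λ a x → zeroˡ a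
          ; *ᵣ-distribʳ  = λ a T U x → distribʳ a (T x) (U x)
          }
        ; *ₗ-*ᵣ-assoc = λ a T b x → *-assoc a (T x) b
        }
      ; -ᴹ‿cong    = λ T≈U x → -‿cong (T≈U x)
      ; -ᴹ‿inverse = (λ T x → -‿inverseˡ (T x)) , (λ T x → -‿inverseʳ (T x))
      }
    ; *ₗ-*ᵣ-coincident = λ a T x → *-comm a (T x)
    }
  }
  where
  module A = CommutativeRing A
  open A hiding (_+_)

minimum : .{{_ : NonZero k}} → Vec ℕ k → ℕ
minimum {suc _} = foldr₁ _⊓_

private
  ∘-homo : (A : CommutativeRing c ℓ) {I J : Set} (f : I → J) →
           IsModuleHomomorphism (Module.rawModule (A ^ᴹ J))
                                (Module.rawModule (A ^ᴹ I)) (_∘ f)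
  ∘-homo A f = record
    { isBimoduleHomomorphism = record
      { +ᴹ-isGroupHomomorphism = record
        { isMonoidHomomorphism = record
          { isMagmaHomomorphism = record
            { isRelHomomorphism = record { cong = λ T≈U x → T≈U (f x) }
            ; homo = λ _ _ _ → A.refl
            }
          ; ε-homo = λ _ → A.refl
          }
        ; ⁻¹-homo = λ _ _ → A.refl
        }
      ; *ₗ-homo = λ _ _ _ → A.refl
      ; *ᵣ-homo = λ _ _ _ → A.refl
      }
    }
    where module A = CommutativeRing A

  δδ : (i j : Fin (suc n)) → i ≤ j → ∀ x →
       punchIn (suc j) (punchIn i x) ≡ punchIn (inject₁ i) (punchIn j x)
  δδ zero    _       _         _       = refl
  δδ (suc i) (suc j) _         zero    = refl
  δδ (suc i) (suc j) (s≤s i≤j) (suc x) = cong suc (δδ i j i≤j x)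

  σσ : (i j : Fin (suc n)) → i ≤ j → ∀ x →
       pinch j (pinch (inject₁ i) x) ≡ pinch i (pinch (suc j) x)
  σσ i       j       _         zero          = refl
  σσ zero    zero    _         (suc zero)    = refl
  σσ zero    (suc j) _         (suc zero)    = refl
  σσ zero    _       _         (suc (suc x)) = refl
  σσ {suc n} (suc i) (suc j) (s≤s i≤j) (suc x) = cong suc (σσ i j i≤j x)

  σδ< : (i : Fin (suc (suc n))) (j : Fin (suc n)) → i ≤ j → ∀ x →
        pinch (suc j) (punchIn (inject₁ i) x) ≡ punchIn i (pinch j x)
  σδ< zero    _       _         _       = refl
  σδ< (suc i) (suc j) _         zero    = refl
  σδ< {suc n} (suc i) (suc j) (s≤s i≤j) (suc x) = cong suc (σδ< i j i≤j x)

  σδ≡ : (i : Fin (suc n)) → ∀ x → pinch i (punchIn (inject₁ i) x) ≡ x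
  σδ≡ zero    _       = refl
  σδ≡ (suc i) zero    = refl
  σδ≡ {suc n} (suc i) (suc x) = cong suc (σδ≡ i x)

  σδ+ : (i : Fin (suc n)) → ∀ x → pinch i (punchIn (suc i) x) ≡ x
  σδ+ _       zero    = refl
  σδ+ zero    (suc x) = refl
  σδ+ {suc n} (suc i) (suc x) = cong suc (σδ+ i x)

  σδ> : (i : Fin (suc (suc n))) (j : Fin (suc n)) → j < i → ∀ x →
        pinch (inject₁ j) (punchIn (suc i) x) ≡ punchIn i (pinch j x)
  σδ> (suc i) _       _         zero    = refl
  σδ> (suc i) zero    _         (suc x) = refl
  σδ> {suc n} (suc i) (suc j) (s≤s j<i) (suc x) = cong suc (σδ> i j j<i x)

  inject₁-↑ˡ : ∀ (i : Fin n) e → inject₁ (i ↑ˡ e) ≡ inject₁ i ↑ˡ e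
  inject₁-↑ˡ zero    e = refl
  inject₁-↑ˡ (suc i) e = cong suc (inject₁-↑ˡ i e)

  ↑ˡ-≤ : ∀ {q r} (i : Fin q) (j : Fin r) e → i ≤ j → (i ↑ˡ e) ≤ (j ↑ˡ e)
  ↑ˡ-≤ i j e = subst₂ ℕ._≤_ (sym (toℕ-↑ˡ i e)) (sym (toℕ-↑ˡ j e))

  ↑ˡ-< : ∀ {q r} (i : Fin q) (j : Fin r) e → i < j → (i ↑ˡ e) < (j ↑ˡ e)
  ↑ˡ-< i j e = subst₂ ℕ._<_ (sym (toℕ-↑ˡ i e)) (sym (toℕ-↑ˡ j e))

  module _ {P Q Q′ R : ℕ → Set} where
    map-square : {f : ∀ {x} → Q x → R x} {g : ∀ {x} → P x → Q x}
                 {f′ : ∀ {x} → Q′ x → R x} {g′ : ∀ {x} → P x → Q′ x} →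
                 (∀ {x} (y : P x) → f (g y) ≡ f′ (g′ y)) →
                 {xs : Vec ℕ k} (ys : All P xs) →
                 map f (map g ys) ≡ map f′ (map g′ ys)
    map-square eq []       = refl
    map-square eq (y ∷ ys) = cong₂ _∷_ (eq y) (map-square eq ys)

  module _ {P Q : ℕ → Set} where
    map-inverse : {f : ∀ {x} → Q x → P x} {g : ∀ {x} → P x → Q x} →
                  (∀ {x} (y : P x) → f (g y) ≡ y) →
                  {xs : Vec ℕ k} (ys : All P xs) → map f (map g ys) ≡ ys
    map-inverse eq []       = refl
    map-inverse eq (y ∷ ys) = cong₂ _∷_ (eq y) (map-inverse eq ys)

module Diagonal {k : ℕ} .{{_ : NonZero k}} (shape : Vec ℕ k) where

  -- The (constant) number nₐ − 1 − n = M_a(p) − p, where n = min − 1.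
  -- The truncated subtractions are exact, as 1 ≤ min ≤ nₐ for shapes of
  -- positive integers.
  excess : ℕ → ℕ
  excess nₐ = nₐ ∸ 1 ∸ (minimum shape ∸ 1)

  M : ℕ → ℕ → ℕ
  M p nₐ = p + excess nₐ

  -- The product over a of [M_a(p)], as the type of heterogeneous tuples.
  Index : ℕ → Set
  Index p = All (λ nₐ → Fin (suc (M p nₐ))) shape

  -- "i ↑ˡ e" is the number i, regarded as an element of [p + e].
  Δ : Fin (suc (suc p)) → Index p → Index (suc p)
  Δ i = map λ {nₐ} → punchIn (i ↑ˡ excess nₐ)

  Σ : Fin (suc p) → Index (suc p) → Index p
  Σ i = map λ {nₐ} → pinch (i ↑ˡ excess nₐ)

  private
    ΔΔ : (i j : Fin (suc (suc p))) → i ≤ j → ∀ x →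
         Δ (suc j) (Δ i x) ≡ Δ (inject₁ i) (Δ j x)
    ΔΔ i j i≤j = map-square λ {nₐ} y →
      trans (δδ (i ↑ˡ excess nₐ) (j ↑ˡ excess nₐ) (↑ˡ-≤ i j _ i≤j) y)
            (cong (λ h → punchIn h (punchIn (j ↑ˡ excess nₐ) y)) (inject₁-↑ˡ i _))

    ΣΣ : (i j : Fin (suc p)) → i ≤ j → ∀ x →
         Σ j (Σ (inject₁ i) x) ≡ Σ i (Σ (suc j) x)
    ΣΣ i j i≤j = map-square λ {nₐ} y →
      trans (cong (λ h → pinch (j ↑ˡ excess nₐ) (pinch h y)) (sym (inject₁-↑ˡ i _)))
            (σσ (i ↑ˡ excess nₐ) (j ↑ˡ excess nₐ) (↑ˡ-≤ i j _ i≤j) y)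

    ΣΔ< : (i : Fin (suc (suc p))) (j : Fin (suc p)) → i ≤ j → ∀ x →
          Σ (suc j) (Δ (inject₁ i) x) ≡ Δ i (Σ j x)
    ΣΔ< i j i≤j = map-square λ {nₐ} y →
      trans (cong (λ h → pinch (suc j ↑ˡ excess nₐ) (punchIn h y)) (sym (inject₁-↑ˡ i _)))
            (σδ< (i ↑ˡ excess nₐ) (j ↑ˡ excess nₐ) (↑ˡ-≤ i j _ i≤j) y)

    ΣΔ≡ : (i : Fin (suc p)) → ∀ x → Σ i (Δ (inject₁ i) x) ≡ x
    ΣΔ≡ i = map-inverse λ {nₐ} y →
      trans (cong (λ h → pinch (i ↑ˡ excess nₐ) (punchIn h y)) (sym (inject₁-↑ˡ i _)))
            (σδ≡ (i ↑ˡ excess nₐ) y)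

    ΣΔ+ : (i : Fin (suc p)) → ∀ x → Σ i (Δ (suc i) x) ≡ x
    ΣΔ+ i = map-inverse λ {nₐ} → σδ+ (i ↑ˡ excess nₐ)

    ΣΔ> : (i : Fin (suc (suc p))) (j : Fin (suc p)) → j < i → ∀ x →
          Σ (inject₁ j) (Δ (suc i) x) ≡ Δ i (Σ j x)
    ΣΔ> i j j<i = map-square λ {nₐ} y →
      trans (cong (λ h → pinch h (punchIn (suc i ↑ˡ excess nₐ) y)) (sym (inject₁-↑ˡ j _)))
            (σδ> (i ↑ˡ excess nₐ) (j ↑ˡ excess nₐ) (↑ˡ-< j i _ j<i) y)

  diagonalTensorModule : (A : CommutativeRing c ℓ) → SimplicialModule A c ℓ
  diagonalTensorModule A = record
    { X      = λ p → A ^ᴹ Index p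
    ; d      = λ i T → T ∘ Δ i
    ; s      = λ i T → T ∘ Σ i
    ; d-homo = λ i → ∘-homo A (Δ i)
    ; s-homo = λ i → ∘-homo A (Σ i)
    ; d-d    = λ i j i≤j T x → reflexive (cong T (ΔΔ i j i≤j x))
    ; s-s    = λ i j i≤j T x → reflexive (cong T (ΣΣ i j i≤j x))
    ; d-s-<  = λ i j i≤j T x → reflexive (cong T (ΣΔ< i j i≤j x))
    ; d-s-≡  = λ i T x → reflexive (cong T (ΣΔ≡ i x))
    ; d-s-+  = λ i T x → reflexive (cong T (ΣΔ+ i x))
    ; d-s->  = λ i j j<i T x → reflexive (cong T (ΣΔ> i j j<i x))
    }
    where open CommutativeRing A using (reflexive)

open Diagonal public using (diagonalTensorModule)

{-# OPTIONS --safe #-}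
-- T ∘ Δᵢ = 0 says that T vanishes on the tuples avoiding the value i, so the
-- horn kernel R_{p,j} consists of the T supported on the tuples that take all
-- the p values i ≠ j.  A k-tuple can do so if and only if p ≤ k.
module Submission where

open import Defs
open import Algebra.Bundles using (CommutativeRing)
open import Data.Bool.Base using (if_then_else_)
open import Data.Fin.Base using (Fin; zero; suc; punchIn; punchOut; splitAt; _↑ˡ_)
open import Data.Fin.Properties
  using (_≟_; all?; any?; ¬∀⟶∃¬; injective⇒≤; ↑ˡ-injective; splitAt-↑ˡ;
         punchIn-injective; punchIn-punchOut; punchInᵢ≢i)
open import Data.Nat.Base using (ℕ; suc; _≤_; _≥_; NonZero)
open import Data.Nat.Properties using (_≥?_; m≤n⇒∃[o]m+o≡n)
open import Data.Product.Base using (∃; _×_; _,_; proj₁; proj₂)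
open import Data.Sum.Base using ([_,_]′)
open import Data.Vec.Base using (Vec; _∷_; lookup)
open import Data.Vec.Relation.Unary.All using (All; []; _∷_; map)
open import Data.Vec.Relation.Unary.All.Properties using (lookup⁺; lookup⁻)
open import Function.Base using (_∘_; const)
open import Function.Bundles using (_⇔_; mk⇔)
open import Relation.Binary.PropositionalEquality
  using (_≡_; _≢_; refl; sym; trans; cong; cong₂; subst)
open import Relation.Nullary.Decidable
  using (Dec; does; ¬?; _→-dec_; decidable-stable; dec-true; dec-false)
open import Relation.Nullary.Negation.Core using (¬_; contradiction)
open import Relation.Unary using (Pred; Decidable; _≐_)

lookup⁺-map : ∀ {a p q} {A : Set a} {P : Pred A p} {Q : Pred A q} {n}
              (f : ∀ {x} → P x → Q x) {xs : Vec A n} (pxs : All P xs) i →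
              lookup⁺ (map f pxs) i ≡ f (lookup⁺ pxs i)
lookup⁺-map f (px ∷ pxs) zero    = refl
lookup⁺-map f (px ∷ pxs) (suc i) = lookup⁺-map f pxs i

lookup⁺-lookup⁻ : ∀ {a p} {A : Set a} (P : Pred A p) {n} (xs : Vec A n)
                  (f : ∀ i → P (lookup xs i)) i →
                  lookup⁺ (lookup⁻ {P = P} {xs = xs} f) i ≡ f i
lookup⁺-lookup⁻ P (_ ∷ _)  f zero    = refl
lookup⁺-lookup⁻ P (_ ∷ xs) f (suc i) = lookup⁺-lookup⁻ P xs (f ∘ suc) i

map-preimage : ∀ {a p q} {A : Set a} {P : Pred A p} {Q : Pred A q} {n}
               (f : ∀ {x} → P x → Q x) {xs : Vec A n} (qxs : All Q xs) →
               (∀ i → ∃ λ y → f y ≡ lookup⁺ qxs i) → ∃ λ pxs → map f pxs ≡ qxs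
map-preimage f []         _   = [] , refl
map-preimage f (qx ∷ qxs) pre with pre zero | map-preimage f qxs (pre ∘ suc)
... | y , fy≡qx | ys , fys≡qxs = y ∷ ys , cong₂ _∷_ fy≡qx fys≡qxs

-- With k = p + o, the first p positions enumerate the values other than `j` through `punchIn j`,
-- and the o positions left over are filled with `j`.
cover-all-but : ∀ {p k} → p ≤ k → (j : Fin (suc p)) →
                ∃ λ (f : Fin k → Fin (suc p)) → ∀ i → i ≢ j → ∃ λ a → f a ≡ i
cover-all-but {p} p≤k j with m≤n⇒∃[o]m+o≡n p≤k
... | o , refl = f , λ i i≢j →
  let i′ = punchOut (i≢j ∘ sym) in
  i′ ↑ˡ o , trans (cong [ punchIn j , const j ]′ (splitAt-↑ˡ p i′ o))
                  (punchIn-punchOut (i≢j ∘ sym))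
  where
  f = [ punchIn j , const j ]′ ∘ splitAt p

module _ {k : ℕ} .{{_ : NonZero k}} (s : Vec ℕ k) where
  open Diagonal s using (excess; M; Index; Δ)

  -- Each coordinate has its own range, which may go beyond p, so the number `i` is embedded anew
  -- into the range of position `a`.
  Takes : ∀ {p} → Fin (suc p) → Index p → Fin k → Set
  Takes i x a = lookup⁺ x a ≡ i ↑ˡ excess (lookup s a)

  takes? : ∀ {p} (i : Fin (suc p)) (x : Index p) → Dec (∃ (Takes i x))
  takes? i x = any? λ a → lookup⁺ x a ≟ i ↑ˡ excess (lookup s a)

  TakesAllBut : ∀ {p} → Fin (suc p) → Index p → Set
  TakesAllBut j x = ∀ i → i ≢ j → ∃ (Takes i x)

  takesAllBut? : ∀ {p} (j : Fin (suc p)) → Decidable (TakesAllBut j)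
  takesAllBut? j x = all? λ i → ¬? (i ≟ j) →-dec takes? i x

  ¬takesAllBut⇒missed : ∀ {p} (j : Fin (suc p)) (x : Index p) → ¬ TakesAllBut j x →
                        ∃ λ i → i ≢ j × ¬ ∃ (Takes i x)
  ¬takesAllBut⇒missed j x ¬all
    with ¬∀⟶∃¬ _ _ (λ i → ¬? (i ≟ j) →-dec takes? i x) ¬all
  -- A refuted implication yields both facts: if its premise failed, or if its conclusion held, it
  -- would be true.
  ... | i , ¬takes = i , (λ i≡j → ¬takes (contradiction i≡j)) , (λ t → ¬takes (const t))

  Δ-misses : ∀ {p} (i : Fin (suc (suc p))) (y : Index p) → ¬ ∃ (Takes i (Δ i y))
  Δ-misses i y (a , eq) =
    punchInᵢ≢i _ _ (trans (sym (lookup⁺-map (λ {nₐ} → punchIn (i ↑ˡ excess nₐ)) y a)) eq)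

  -- In each coordinate `punchIn` hits everything except the omitted value, so a preimage can be
  -- chosen by `punchOut` one coordinate at a time. With `Δ-misses` this determines the image of
  -- `Δ i`.
  missed⇒Δ : ∀ {p} (i : Fin (suc (suc p))) (x : Index (suc p)) →
             ¬ ∃ (Takes i x) → ∃ λ y → Δ i y ≡ x
  missed⇒Δ i x missed = map-preimage (λ {nₐ} → punchIn (i ↑ˡ excess nₐ)) x λ a →
    _ , punchIn-punchOut (λ eq → missed (a , sym eq))

  -- Pigeonhole: choose a position for each of the p values `punchIn j i`. A position holds a single
  -- value, so the choice is an injection from `Fin p` to `Fin k`.
  takesAllBut⇒≤ : ∀ {p} (j : Fin (suc p)) (x : Index p) → TakesAllBut j x → p ≤ k
  takesAllBut⇒≤ {p} j x all = injective⇒≤ {f = proj₁ ∘ position} λ {i} {i′} eq →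
    punchIn-injective j i i′ (↑ˡ-injective _ _ _
      (trans (sym (proj₂ (position i)))
             (subst (Takes (punchIn j i′) x) (sym eq) (proj₂ (position i′)))))
    where
    position : (i : Fin p) → ∃ (Takes (punchIn j i) x)
    position i = all (punchIn j i) (punchInᵢ≢i j i)

  ≤⇒takesAllBut : ∀ {p} → p ≤ k → (j : Fin (suc p)) → ∃ (TakesAllBut j)
  ≤⇒takesAllBut {p} p≤k j with cover-all-but p≤k j
  ... | f , covers = lookup⁻ g , λ i i≢j → let a , fa≡i = covers i i≢j in
    a , trans (lookup⁺-lookup⁻ (λ nₐ → Fin (suc (M p nₐ))) s g a) (cong (_↑ˡ _) fa≡i)
    where
    g : ∀ a → Fin (suc (M p (lookup s a)))
    g a = f a ↑ˡ excess (lookup s a)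

  module _ {c ℓ} (A : CommutativeRing c ℓ) where
    open CommutativeRing A using (Carrier; _≈_; 0#; 1#; reflexive)

    private
      X∙ = diagonalTensorModule s A

    horn-vanishes : ∀ {p} (j : Fin (suc (suc p))) {T} → hornKernel X∙ (suc p) j T →
                    ∀ x → ¬ TakesAllBut j x → T x ≈ 0#
    horn-vanishes j T∈R x ¬all with ¬takesAllBut⇒missed j x ¬all
    ... | i , i≢j , missed with missed⇒Δ i x missed
    -- Now `x` is `Δ i y`, so the value of `T` there is the value at `y` of its `i`-th face, which
    -- is zero on the horn kernel.
    ... | y , refl = T∈R (i , i≢j) y

    -- The characteristic function of the largest support that the horn kernel allows; it can be
    -- defined because `TakesAllBut` is decidable.
    indicator : ∀ {p} → Fin (suc p) → Index p → Carrier
    indicator j x = if does (takesAllBut? j x) then 1# else 0#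

    indicator∈horn : ∀ {p} (j : Fin (suc (suc p))) →
                     hornKernel X∙ (suc p) j (indicator j)
    indicator∈horn j (i , i≢j) y = reflexive (cong (λ b → if b then 1# else 0#)
      (dec-false (takesAllBut? j (Δ i y)) λ all → Δ-misses i y (all i i≢j)))

    indicator≈1 : ∀ {p} (j : Fin (suc p)) {x} → TakesAllBut j x → indicator j x ≈ 1#
    indicator≈1 j {x} all =
      reflexive (cong (λ b → if b then 1# else 0#) (dec-true (takesAllBut? j x) all))

corollary3p9 : ∀ {c ℓ} (A : CommutativeRing c ℓ) → let open CommutativeRing A in
    ¬ (1# ≈ 0#) →
    ∀ {k : ℕ} .{{_ : NonZero k}} (s : Vec ℕ k) → All NonZero s →
    ∀ (p : ℕ) .{{_ : NonZero p}} (j : Fin (suc p)) →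
    let X∙ = diagonalTensorModule s A in
    (¬ (hornKernel X∙ p j ≐ ｛0｝ (SimplicialModule.X X∙ p))) ⇔ k ≥ p
corollary3p9 A 1≉0 {k} s _ (suc p) j = mk⇔ to from
  where
  module A = CommutativeRing A
  X∙ = diagonalTensorModule s A
  R = hornKernel X∙ (suc p) j
  O = ｛0｝ (SimplicialModule.X X∙ (suc p))

  to : ¬ (R ≐ O) → k ≥ suc p
  -- Non-triviality is a negated statement and yields only a double negation of the bound, which
  -- decidability of the order removes.
  to R≢0 = decidable-stable (k ≥? suc p) λ k≱p → R≢0
    ( (λ T∈R x → horn-vanishes s A j T∈R x (k≱p ∘ takesAllBut⇒≤ s j x))
    , (λ T≈0 (i , _) y → T≈0 (Diagonal.Δ s i y)))

  from : k ≥ suc p → ¬ (R ≐ O)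
  from k≥p (R⊆0 , _) = let x , all = ≤⇒takesAllBut s k≥p j in
    -- The indicator is 1 at the covering tuple `x`. If the kernel were trivial it would be 0 there,
    -- which is possible only over the zero ring.
    1≉0 (A.trans (A.sym (indicator≈1 s A j {x} all))
                 (R⊆0 {indicator s A j} (indicator∈horn s A j) x))
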